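{- For every $g\ge 1$, the sequence $T^g=\big((x^g_n,y^g_n)\big)_{n\ge 0}$ defined recursively by the algorithm described in the context coincides with the $g$-sequence $S^g=\big((a^g_n,b^g_n)\big)_{n\ge0}$ of all 2-Star Nim positions with Sprague-Grundy value $g$; that is, $(x^g_n,y^g_n)=(a^g_n,b^g_n)$ for all $n\ge 0$.
   Context: 2-Star Nim: a position is a pair $(a,b)$ of nonnegative integers, not both $0$ (one token on square $a$ of a first strip and one on square $b$ of a second strip, the two strips sharing their square $0$, which holds at most one token). A move replaces exactly one coordinate by a smaller nonnegative integer, provided the result is not $(0,0)$. A player unable to move loses. $\mathcal{G}(a,b)$ is the Sprague-Grundy value, $\mathcal{G}(p)=\operatorname{mex}\{\mathcal{G}(q): q\text{ reachable from }p\text{ in one move}\}$, where $\operatorname{mex}(S)$ is the least nonnegative integer not in $S$. It is symmetric in $a,b$, and positions are considered up to order, written with $a\le b$. The $g$-sequence: $S^g=\big((a^g_0,b^g_0),(a^g_1,b^g_1),\ldots\big)$ lists all positions $(a,b)$ with $a\le b$ and $\mathcal{G}(a,b)=g$, ordered so that $a^g_i<a^g_j$ whenever $i<j$. The algorithm: $T^0:=S^0=\big((0,1),(2,2),(3,3),(4,4),\ldots\big)$. For $g\ge1$, given the sequences $T^k$ for $k<g$ and the terms $(x^g_i,y^g_i)$ for $i<n$: (1) $x^g_n=\operatorname{mex}\{x^g_i,y^g_i\mid 0\le i<n\}$; (2) $y^g_n=x^g_n+z$, where $z$ is the smallest nonnegative integer such that $(x^g_n,x^g_n+z)$ is a legal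 position (i.e. is not $(0,0)$) and (a) $x^g_n+z\notin\{y^g_l\mid 0\le l<n\}$, and (b) $(x^g_n,x^g_n+z)$ is not a term of $T^k$ for any $k<g$. -}

module Defs where

open import Data.List.Base using (List; map; upTo; _++_; filter)
open import Data.List.Extrema.Nat using (max; xs≤max)
open import Data.List.Membership.DecPropositional using () renaming (_∈?_ to member?)
open import Data.List.Membership.Propositional using (_∈_; mapWith∈)
open import Data.List.Membership.Propositional.Properties
  using (mapWith∈-cong; ∈-map⁺; ∈-map⁻; ∈-++⁺ˡ; ∈-++⁺ʳ; ∈-++⁻; ∈-filter⁺; ∈-filter⁻; ∈-upTo⁺; ∈-upTo⁻)
open import Data.List.Relation.Unary.All using () renaming (lookup to All-lookup)
open import Data.List.Relation.Unary.Any.Properties using (mapWith∈⁺; mapWith∈⁻)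
open import Data.Nat.Base using (ℕ; zero; suc; _+_; _<_; _≤_; _≥_)
open import Data.Nat.Induction using (<-wellFounded)
open import Data.Nat.Properties
  using (_≟_; n≮0; n<1+n; 1+n≰n; m<1+n⇒m<n∨m≡n; +-monoˡ-<; +-monoʳ-<)
open import Data.Product.Base using (_×_; _,_; proj₁; proj₂; ∃; ∃-syntax)
open import Data.Product.Properties using (≡-dec)
open import Data.Sum.Base using (_⊎_; inj₁; inj₂)
open import Function.Base using (flip; _on_)
open import Induction.WellFounded using (Acc; acc; WellFounded; module Subrelation)
open import Level using (0ℓ)
open import Relation.Binary.Construct.On using () renaming (wellFounded to on-wellFounded)
open import Relation.Binary.PropositionalEquality
  using (_≡_; _≢_; refl; sym; trans; cong)
open import Relation.Nullary using (¬_; yes; no; ¬?; contradiction)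
open import Relation.Unary using (Pred; Decidable; ∁)

IsLeast : Pred ℕ 0ℓ → Pred ℕ 0ℓ
IsLeast P m = P m × (∀ k → k < m → ¬ P k)

-- For k below the mex this yields ¬ ¬ S k, which is S k for the finite, decidable
-- sets to which it is applied.
IsMex : Pred ℕ 0ℓ → Pred ℕ 0ℓ
IsMex S = IsLeast (∁ S)

least-below : ∀ {P} → Decidable P → ∀ n → ∃ (IsLeast P) ⊎ (∀ k → k < n → ¬ P k)
least-below P? zero = inj₂ λ k k<0 _ → n≮0 k<0
least-below {P} P? (suc n) with least-below P? n
... | inj₁ found = inj₁ found
... | inj₂ none with P? n
...   | yes Pn = inj₁ (n , Pn , none)
...   | no ¬Pn = inj₂ none′
  where
  none′ : ∀ k → k < suc n → ¬ P k
  none′ k k<1+n with m<1+n⇒m<n∨m≡n k<1+n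
  ... | inj₁ k<n  = none k k<n
  ... | inj₂ refl = ¬Pn

least : ∀ {P} → Decidable P → ∃ P → ∃ (IsLeast P)
least P? (n , Pn) with least-below P? (suc n)
... | inj₁ found = found
... | inj₂ none  = contradiction Pn (none n (n<1+n n))

mex-exists : ∀ xs → ∃ (IsMex (_∈ xs))
mex-exists xs = least (λ k → ¬? (member? _≟_ k xs))
  (suc (max 0 xs) , λ big∈xs → 1+n≰n (All-lookup (xs≤max 0 xs) big∈xs))

mex : List ℕ → ℕ
mex xs = proj₁ (mex-exists xs)

-- Pairs are ordered here; a position up to order is represented by the pair
-- whose coordinates are in increasing order, as in IsGSequence.
Pair : Set
Pair = ℕ × ℕ

Legal : Pred Pair 0ℓ
Legal p = p ≢ (0 , 0)

infix 4 _⟶_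

data _⟶_ : Pair → Pair → Set where
  move₁ : ∀ {a a′ b} → a′ < a → Legal (a′ , b) → (a , b) ⟶ (a′ , b)
  move₂ : ∀ {a b b′} → b′ < b → Legal (a , b′) → (a , b) ⟶ (a , b′)

legal? : Decidable Legal
legal? p = ¬? (≡-dec _≟_ _≟_ p (0 , 0))

options : Pair → List Pair
options (a , b) = filter legal? (map (_, b) (upTo a) ++ map (a ,_) (upTo b))

∈-options⁺ : ∀ {p q} → p ⟶ q → q ∈ options p
∈-options⁺ (move₁ {b = b} a′<a legal) =
  ∈-filter⁺ legal? (∈-++⁺ˡ (∈-map⁺ (_, b) (∈-upTo⁺ a′<a))) legal
∈-options⁺ (move₂ {a = a} {b = b} b′<b legal) =
  ∈-filter⁺ legal? (∈-++⁺ʳ (map (_, b) (upTo a)) (∈-map⁺ (a ,_) (∈-upTo⁺ b′<b))) legal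

∈-options⁻ : ∀ {p q} → q ∈ options p → p ⟶ q
∈-options⁻ {a , b} q∈ with ∈-filter⁻ legal? {xs = map (_, b) (upTo a) ++ map (a ,_) (upTo b)} q∈
... | q∈′ , legal with ∈-++⁻ (map (_, b) (upTo a)) q∈′
...   | inj₁ q∈₁ with _ , a′∈ , refl ← ∈-map⁻ (_, b) q∈₁ = move₁ (∈-upTo⁻ a′∈) legal
...   | inj₂ q∈₂ with _ , b′∈ , refl ← ∈-map⁻ (a ,_) q∈₂ = move₂ (∈-upTo⁻ b′∈) legal

tokenSum : Pair → ℕ
tokenSum (a , b) = a + b

⟶-decreases : ∀ {p q} → p ⟶ q → tokenSum q < tokenSum p
⟶-decreases (move₁ {b = b} a′<a _) = +-monoˡ-< b a′<a
⟶-decreases (move₂ {a = a} b′<b _) = +-monoʳ-< a b′<b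

⟶-wellFounded : WellFounded (flip _⟶_)
⟶-wellFounded = Subrelation.wellFounded {_<₂_ = _<_ on tokenSum} ⟶-decreases
  (on-wellFounded tokenSum <-wellFounded)

optionValues : ∀ p → (∀ q → p ⟶ q → ℕ) → List ℕ
optionValues p v = mapWith∈ (options p) λ {q} q∈ → v q (∈-options⁻ q∈)

∈-optionValues⁺ : ∀ {p q k} (v : ∀ q → p ⟶ q → ℕ) → p ⟶ q → (∀ p⟶q → v q p⟶q ≡ k) →
                  k ∈ optionValues p v
∈-optionValues⁺ {q = q} v p⟶q eq =
  mapWith∈⁺ _ (q , ∈-options⁺ p⟶q , sym (eq _))

∈-optionValues⁻ : ∀ {p k} (v : ∀ q → p ⟶ q → ℕ) → k ∈ optionValues p v →
                  ∃[ q ] ∃[ p⟶q ] v q p⟶q ≡ k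
∈-optionValues⁻ {p} v k∈ with q , q∈ , eq ← mapWith∈⁻ (options p) _ k∈ =
  q , ∈-options⁻ q∈ , sym eq

𝒢-acc : ∀ p → Acc (flip _⟶_) p → ℕ
𝒢-acc p (acc rec) = mex (optionValues p λ q p⟶q → 𝒢-acc q (rec p⟶q))

-- At the pair (0 , 0), which is not a position, the value is meaningless.
𝒢 : Pair → ℕ
𝒢 p = 𝒢-acc p (⟶-wellFounded p)

𝒢-acc-irrelevant : ∀ p (α β : Acc (flip _⟶_) p) → 𝒢-acc p α ≡ 𝒢-acc p β
𝒢-acc-irrelevant p (acc α) (acc β) = cong mex (mapWith∈-cong (options p) _ _
  λ {q} q∈ → 𝒢-acc-irrelevant q (α (∈-options⁻ q∈)) (β (∈-options⁻ q∈)))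

OptionValue : Pair → Pred ℕ 0ℓ
OptionValue p k = ∃[ q ] (p ⟶ q × 𝒢 q ≡ k)

𝒢-acc-isMex : ∀ p (α : Acc (flip _⟶_) p) → IsMex (OptionValue p) (𝒢-acc p α)
𝒢-acc-isMex p (acc rec) =
  (λ v → m∉ (to v)) , λ k k<m k∉ → below k k<m (λ k∈ → k∉ (from k∈))
  where
  val : ∀ q → p ⟶ q → ℕ
  val q p⟶q = 𝒢-acc q (rec p⟶q)

  values : List ℕ
  values = optionValues p val

  m∉ : ¬ mex values ∈ values
  m∉ = proj₁ (proj₂ (mex-exists values))

  below : ∀ k → k < mex values → ¬ ¬ k ∈ values
  below = proj₂ (proj₂ (mex-exists values))

  to : ∀ {k} → OptionValue p k → k ∈ values
  to (q , p⟶q , refl) =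
    ∈-optionValues⁺ val p⟶q λ p⟶q′ → 𝒢-acc-irrelevant q (rec p⟶q′) (⟶-wellFounded q)

  from : ∀ {k} → k ∈ values → OptionValue p k
  from k∈ with q , p⟶q , eq ← ∈-optionValues⁻ val k∈ =
    q , p⟶q , trans (𝒢-acc-irrelevant q (⟶-wellFounded q) (rec p⟶q)) eq

𝒢-isMex : ∀ p → IsMex (OptionValue p) (𝒢 p)
𝒢-isMex p = 𝒢-acc-isMex p (⟶-wellFounded p)

PairSeq : Set
PairSeq = ℕ → Pair

infix 4 _isTermOf_

_isTermOf_ : Pair → PairSeq → Set
p isTermOf s = ∃[ n ] s n ≡ p

record IsGSequence (g : ℕ) (S : PairSeq) : Set where
  field
    legal    : ∀ n → Legal (S n)
    ordered  : ∀ n → proj₁ (S n) ≤ proj₂ (S n)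
    value    : ∀ n → 𝒢 (S n) ≡ g
    complete : ∀ a b → Legal (a , b) → a ≤ b → 𝒢 (a , b) ≡ g → (a , b) isTermOf S
    sorted   : ∀ {i j} → i < j → proj₁ (S i) < proj₁ (S j)

T⁰ : PairSeq
T⁰ zero    = 0 , 1
T⁰ (suc n) = 2 + n , 2 + n

module _ (T : ℕ → PairSeq) (g n : ℕ) where

  UsedBefore : Pred ℕ 0ℓ
  UsedBefore m = ∃[ i ] (i < n × (m ≡ proj₁ (T g i) ⊎ m ≡ proj₂ (T g i)))

  record Admissible (x z : ℕ) : Set where
    field
      legal : Legal (x , x + z)
      cond-a : ∀ l → l < n → x + z ≢ proj₂ (T g l)
      cond-b : ∀ k → k < g → ¬ (x , x + z) isTermOf T k

-- The recursion determines T g n from T k for k < g and T g i for i < n.  It is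
-- given by its defining equations, not as a function, because neither the
-- existence of the least z nor the decidability of being a term of the infinite
-- sequence T k is immediate.
record IsAlgorithmOutput (T : ℕ → PairSeq) : Set where
  field
    base  : ∀ n → T 0 n ≡ T⁰ n
    step₁ : ∀ g n → g ≥ 1 → IsMex (UsedBefore T g n) (proj₁ (T g n))
    step₂ : ∀ g n → g ≥ 1 → let (x , y) = T g n in
            ∃[ z ] (IsLeast (Admissible T g n x) z × y ≡ x + z)

{-# OPTIONS --safe #-}
-- Fix g.  A row a contains the value g at most once, since two entries of a row
-- are joined by a move.  It contains g at least once: choose an entry to the right
-- of all values below g in row a, with no g in its column in the rows before a; if
-- its value exceeds g, then the option of value g lies in row a.  By symmetry the
-- column of g in row a defines an involution f of ℕ, and S^g lists the pairs
-- (a , f a) with a ≤ f a.  The first number not used by the earlier pairs is the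
-- next such a.  For a ≤ y < f a, the pair (a , y) has a value k < g, so that it is
-- a term of S^k, or a value above g, so that some (a′ , y) with a′ < a has value g
-- and y is the larger coordinate of an earlier term; either way the algorithm
-- rejects y.
module Submission where

open import Defs
open import Data.Empty using (⊥; ⊥-elim)
open import Data.Nat.Base using (ℕ; zero; suc; _+_; _∸_; _≤_; _<_; _≥_; z≤n; s≤s)
open import Data.Nat.Induction using (<-rec)
open import Data.Nat.Properties
open import Data.Product.Base using (_×_; _,_; proj₁; proj₂; ∃; ∃-syntax)
open import Data.Sum.Base using (inj₁; inj₂)
open import Function.Base using (flip)
open import Induction.WellFounded using (Acc; acc)
open import Level using (0ℓ)
open import Relation.Binary.Definitions using (tri<; tri≈; tri>)
open import Relation.Binary.PropositionalEquality
  using (_≡_; _≢_; refl; sym; trans; cong; cong₂; subst)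
open import Relation.Nullary using (¬_; contradiction; _×-dec_)
open import Relation.Nullary.Decidable using (map′)
open import Relation.Unary using (Pred; Decidable; _⊆_)

-- Least numbers, mex and common bounds.

IsLeast-unique : ∀ {P m n} → IsLeast P m → IsLeast P n → m ≡ n
IsLeast-unique {m = m} {n} (Pm , m-least) (Pn , n-least) with <-cmp m n
... | tri< m<n _ _ = contradiction Pm (n-least m m<n)
... | tri≈ _ m≡n _ = m≡n
... | tri> _ _ n<m = contradiction Pn (m-least n n<m)

IsMex-resp : ∀ {P Q : Pred ℕ 0ℓ} {m} → P ⊆ Q → Q ⊆ P → IsMex P m → IsMex Q m
IsMex-resp P⊆Q Q⊆P (m∉P , below) =
  (λ m∈Q → m∉P (Q⊆P m∈Q)) , λ k k<m k∉Q → below k k<m λ k∈P → k∉Q (P⊆Q k∈P)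

-- Serves to pass beyond finitely many columns at once; a sum stands in for their maximum.
bounded-witnesses : ∀ {Q : ℕ → Pred ℕ 0ℓ} n → (∀ {i} → i < n → ∃ (Q i)) →
                    ∃[ m ] (∀ {i} → i < n → ∃[ b ] (b < m × Q i b))
bounded-witnesses zero    _ = 0 , λ ()
bounded-witnesses {Q} (suc n) w with bounded-witnesses {Q} n (λ i<n → w (m<n⇒m<1+n i<n)) | w (n<1+n n)
... | m , earlier | b , Qnb = suc b + m , witness
  where
  witness : ∀ {i} → i < suc n → ∃[ b′ ] (b′ < suc b + m × Q i b′)
  witness i<1+n with m<1+n⇒m<n∨m≡n i<1+n
  ... | inj₂ refl = b , m≤m+n (suc b) m , Qnb
  ... | inj₁ i<n with b′ , b′<m , q ← earlier i<n = b′ , m≤n⇒m≤o+n (suc b) b′<m , q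

-- Pairs of a given value, and symmetry.

-- A record, not a product, and many lemmas about it are abstract: otherwise
-- with-abstraction normalises 𝒢 and unfolds its well-founded recursion.
record HasValue (g a b : ℕ) : Set where
  constructor has-value
  field
    legal : Legal (a , b)
    value : 𝒢 (a , b) ≡ g

abstract
  hasValue? : ∀ g a → Decidable (HasValue g a)
  hasValue? g a b = map′ (λ (legal , value) → has-value legal value)
    (λ (has-value legal value) → legal , value) (legal? (a , b) ×-dec (𝒢 (a , b) ≟ g))

  Legal⇒HasValue : ∀ {a b} → Legal (a , b) → ∃[ g ] HasValue g a b
  Legal⇒HasValue legal = _ , has-value legal refl

Legal-swap : ∀ {a b} → Legal (a , b) → Legal (b , a)
Legal-swap legal refl = legal refl

swap-move : ∀ {a b c d} → (a , b) ⟶ (c , d) → (b , a) ⟶ (d , c)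
swap-move (move₁ a′<a legal) = move₂ a′<a (Legal-swap legal)
swap-move (move₂ b′<b legal) = move₁ b′<b (Legal-swap legal)

-- Swapping matches the options of the two pairs, so by induction along moves both values are the
-- mex of one set.
𝒢-swap : ∀ a b → 𝒢 (a , b) ≡ 𝒢 (b , a)
𝒢-swap a b = go a b (⟶-wellFounded (a , b))
  where
  go : ∀ a b → Acc (flip _⟶_) (a , b) → 𝒢 (a , b) ≡ 𝒢 (b , a)
  go a b (acc rec) = IsLeast-unique (IsMex-resp to from (𝒢-isMex (a , b))) (𝒢-isMex (b , a))
    where
    to : OptionValue (a , b) ⊆ OptionValue (b , a)
    to ((c , d) , p⟶q , eq) =
      (d , c) , swap-move p⟶q , trans (sym (go c d (rec p⟶q))) eq

    from : OptionValue (b , a) ⊆ OptionValue (a , b)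
    from ((d , c) , p⟶q , eq) =
      (c , d) , swap-move p⟶q , trans (go c d (rec (swap-move p⟶q))) eq

abstract
  HasValue-swap : ∀ {g a b} → HasValue g a b → HasValue g b a
  HasValue-swap {a = a} {b} (has-value legal eq) =
    has-value (Legal-swap legal) (trans (𝒢-swap b a) eq)

-- The value `g` in a row: uniqueness and existence.

HasValue-once : ∀ {g a b c} → b < c → HasValue g a b → ¬ HasValue g a c
HasValue-once {a = a} {c = c} b<c (has-value legal-b eq-b) (has-value _ eq-c) =
  proj₁ (𝒢-isMex (a , c)) (_ , move₂ b<c legal-b , trans eq-b (sym eq-c))

HasValue-functional : ∀ {g a b c} → HasValue g a b → HasValue g a c → b ≡ c
HasValue-functional {b = b} {c} v w with <-cmp b c
... | tri< b<c _ _ = contradiction w (HasValue-once b<c v)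
... | tri≈ _ b≡c _ = b≡c
... | tri> _ _ c<b = contradiction v (HasValue-once c<b w)

-- `IsMex` yields an option of value `k` only up to double negation, hence the form that the two
-- kinds of move cannot both be refuted.
HasValue-option : ∀ {g k a b} → HasValue g a b → k < g →
                  (∀ {a′} → a′ < a → ¬ HasValue k a′ b) →
                  ¬ (∀ {b′} → b′ < b → ¬ HasValue k a b′)
HasValue-option {k = k} {a} {b} (has-value _ refl) k<g none₁ none₂ =
  proj₂ (𝒢-isMex (a , b)) k k<g λ
    { (_ , move₁ a′<a legal , eq) → none₁ a′<a (has-value legal eq)
    ; (_ , move₂ b′<b legal , eq) → none₂ b′<b (has-value legal eq)
    }

HasValue-injective : ∀ {g a b c} → HasValue g a c → HasValue g b c → a ≡ b
HasValue-injective v w = HasValue-functional (HasValue-swap v) (HasValue-swap w)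

HasValue-total-step : ∀ a g → (∀ {a′} → a′ < a → ∃ (HasValue g a′)) →
                      (∀ {g′} → g′ < g → ∃ (HasValue g′ a)) → ∃ (HasValue g a)
HasValue-total-step a g rows values
  with m₁ , rows′   ← bounded-witnesses {HasValue g} a rows
     | m₂ , values′ ← bounded-witnesses {λ g′ → HasValue g′ a} g values
  with least-below (hasValue? g a) (suc (suc (m₁ + m₂)))
... | inj₁ (b , v , _) = b , v
... | inj₂ none = ⊥-elim absurd
  where
  -- Beyond `m₁` and `m₂`, this column differs from those of `g` in earlier rows and of smaller
  -- values in row `a`; the `suc` also makes `(a , c)` legal.
  c : ℕ
  c = suc (m₁ + m₂)

  rows-miss-c : ∀ {a′} → a′ < a → ¬ HasValue g a′ c
  rows-miss-c a′<a w with b , b<m₁ , v ← rows′ a′<a =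
    <⇒≢ (<-trans b<m₁ (s≤s (m≤m+n m₁ m₂))) (HasValue-functional v w)

  absurd : ⊥
  absurd with h , w ← Legal⇒HasValue {a} {c} (λ ()) with <-cmp h g
  ... | tri≈ _ refl _ = none c (n<1+n c) w
  ... | tri< h<g _ _ with b , b<m₂ , v ← values′ h<g =
    <⇒≢ (<-trans b<m₂ (s≤s (m≤n+m m₂ m₁))) (HasValue-functional v w)
  ... | tri> _ _ g<h = HasValue-option w g<h rows-miss-c λ b<c → none _ (m<n⇒m<1+n b<c)

abstract
  -- The outer induction is on the row, for all values at once; the inner one is on the value within
  -- the row.
  HasValue-total : ∀ a g → ∃ (HasValue g a)
  HasValue-total = <-rec _ λ a rows → <-rec _ λ g values →
    HasValue-total-step a g (λ a′<a → rows a′<a g) values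

-- The involution `f` for the value `g`.
partner : ℕ → ℕ → ℕ
partner g a = proj₁ (HasValue-total a g)

partner-HasValue : ∀ g a → HasValue g a (partner g a)
partner-HasValue g a = proj₂ (HasValue-total a g)

-- The `g`-sequence, enumerated by smaller coordinates.

IsSmaller : ℕ → Pred ℕ 0ℓ
IsSmaller g a = a ≤ partner g a

HasValue⇒IsSmaller : ∀ {g a b} → HasValue g a b → a ≤ b → IsSmaller g a
HasValue⇒IsSmaller {g} {a} v = subst (a ≤_) (HasValue-functional v (partner-HasValue g a))

-- Let `m` bound the columns of `g` in the rows below `n`. If `m + n` is not the smaller coordinate
-- of its pair, its partner is; were the partner below `n`, its column `m + n` would be below `m`.
smaller-unbounded : ∀ g n → ∃[ a ] (n ≤ a × IsSmaller g a)
smaller-unbounded g n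
  with m , early ← bounded-witnesses {HasValue g} n (λ {i} _ → HasValue-total i g)
  with ≤-total (m + n) (partner g (m + n)) | partner-HasValue g (m + n)
... | inj₁ a≤b | _ = m + n , m≤n+m n m , a≤b
... | inj₂ b≤a | v = _ , ≮⇒≥ b≮n , HasValue⇒IsSmaller (HasValue-swap v) b≤a
  where
  b≮n : ¬ partner g (m + n) < n
  b≮n b<n with c , c<m , w ← early b<n =
    <⇒≢ (<-≤-trans c<m (m≤m+n m n)) (HasValue-functional w (HasValue-swap v))

abstract
  next-smaller : ∀ g n → ∃ (IsLeast (λ a → n ≤ a × IsSmaller g a))
  next-smaller g n = least (λ a → (n ≤? a) ×-dec (a ≤? partner g a)) (smaller-unbounded g n)

smaller : ℕ → ℕ → ℕ
smaller g zero    = proj₁ (next-smaller g 0)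
smaller g (suc n) = proj₁ (next-smaller g (suc (smaller g n)))

smaller-IsSmaller : ∀ g n → IsSmaller g (smaller g n)
smaller-IsSmaller g zero    = proj₂ (proj₁ (proj₂ (next-smaller g 0)))
smaller-IsSmaller g (suc n) = proj₂ (proj₁ (proj₂ (next-smaller g (suc (smaller g n)))))

smaller-step : ∀ g n → smaller g n < smaller g (suc n)
smaller-step g n = proj₁ (proj₁ (proj₂ (next-smaller g (suc (smaller g n)))))

smaller-mono-< : ∀ g {i j} → i < j → smaller g i < smaller g j
smaller-mono-< g {i} {suc j} i<1+j with m<1+n⇒m<n∨m≡n i<1+j
... | inj₁ i<j  = <-trans (smaller-mono-< g i<j) (smaller-step g j)
... | inj₂ refl = smaller-step g j

n≤smaller : ∀ g n → n ≤ smaller g n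
n≤smaller g zero    = z≤n
n≤smaller g (suc n) = ≤-<-trans (n≤smaller g n) (smaller-step g n)

smaller-complete-below : ∀ g n {a} → IsSmaller g a → a < smaller g n → ∃[ i ] smaller g i ≡ a
smaller-complete-below g zero s a< =
  contradiction (z≤n , s) (proj₂ (proj₂ (next-smaller g 0)) _ a<)
smaller-complete-below g (suc n) {a} s a< with <-cmp a (smaller g n)
... | tri< a<′ _ _ = smaller-complete-below g n s a<′
... | tri≈ _ eq _  = n , sym eq
... | tri> _ _ >a  =
  contradiction (>a , s) (proj₂ (proj₂ (next-smaller g (suc (smaller g n)))) _ a<)

smaller-complete : ∀ g {a} → IsSmaller g a → ∃[ i ] smaller g i ≡ a
smaller-complete g {a} s = smaller-complete-below g (suc a) s (n≤smaller g (suc a))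

gSequence : ℕ → PairSeq
gSequence g n = smaller g n , partner g (smaller g n)

gSequence-isGSequence : ∀ g → IsGSequence g (gSequence g)
gSequence-isGSequence g = record
  { legal    = λ n → HasValue.legal (partner-HasValue g (smaller g n))
  ; ordered  = smaller-IsSmaller g
  ; value    = λ n → HasValue.value (partner-HasValue g (smaller g n))
  ; complete = complete
  ; sorted   = smaller-mono-< g
  }
  where
  complete : ∀ a b → Legal (a , b) → a ≤ b → 𝒢 (a , b) ≡ g → (a , b) isTermOf gSequence g
  complete a b legal a≤b eq
    with i , refl ← smaller-complete g (HasValue⇒IsSmaller (has-value legal eq) a≤b) =
    i , cong (smaller g i ,_) (HasValue-functional (partner-HasValue g _) (has-value legal eq))

IsGSequence-resp : ∀ {g S S′} → (∀ n → S′ n ≡ S n) → IsGSequence g S → IsGSequence g S′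
IsGSequence-resp {g} {S} {S′} S′≗S isG = record
  { legal    = λ n → subst Legal (sym (S′≗S n)) (legal n)
  ; ordered  = λ n → subst (λ p → proj₁ p ≤ proj₂ p) (sym (S′≗S n)) (ordered n)
  ; value    = λ n → trans (cong 𝒢 (S′≗S n)) (value n)
  ; complete = λ a b l a≤b eq → let n , Sn≡ = complete a b l a≤b eq in n , trans (S′≗S n) Sn≡
  ; sorted   = λ {i} {j} i<j → subst (λ p → proj₁ p < _) (sym (S′≗S i))
                                 (subst (λ p → _ < proj₁ p) (sym (S′≗S j)) (sorted i<j))
  }
  where open IsGSequence isG

-- The sequence of value 0.

abstract
  0-1-HasValue : HasValue 0 0 1
  0-1-HasValue = has-value (λ ()) refl

-- A positive value would require an option of value 0, but each earlier row has its 0 in another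
-- column: row 0 in column 1, row 1 in column 0, row `2 + m` on the diagonal. Symmetry excludes the
-- other kind of move.
diagonal-HasValue : ∀ n → HasValue 0 (2 + n) (2 + n)
diagonal-HasValue = <-rec _ step
  where
  module _ (n : ℕ) (rec : ∀ {m} → m < n → HasValue 0 (2 + m) (2 + m)) where
    off-diagonal : ∀ {a} → a < 2 + n → ¬ HasValue 0 a (2 + n)
    off-diagonal {0} _ v = contradiction (HasValue-functional v 0-1-HasValue) λ ()
    off-diagonal {1} _ v =
      contradiction (HasValue-functional v (HasValue-swap 0-1-HasValue)) λ ()
    off-diagonal {suc (suc m)} (s≤s (s≤s m<n)) v =
      <⇒≢ (s≤s (s≤s m<n)) (HasValue-functional (rec m<n) v)

    step : HasValue 0 (2 + n) (2 + n)
    step with Legal⇒HasValue {2 + n} {2 + n} (λ ())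
    ... | zero  , v = v
    ... | suc _ , v = ⊥-elim (HasValue-option v (s≤s z≤n) off-diagonal
      λ b<2+n w → off-diagonal b<2+n (HasValue-swap w))

T⁰-isGSequence : IsGSequence 0 T⁰
T⁰-isGSequence = record
  { legal    = λ { zero → λ () ; (suc n) → λ () }
  ; ordered  = λ { zero → z≤n ; (suc n) → ≤-refl }
  ; value    = value
  ; complete = λ a b legal a≤b eq → term a b (has-value legal eq) a≤b
  ; sorted   = sorted
  }
  where
  -- With p a variable, comparing 𝒢 (T⁰ n) to 𝒢 (a , b) does not evaluate 𝒢.
  𝒢-≡ : ∀ {p a b} → p ≡ (a , b) → HasValue 0 a b → 𝒢 p ≡ 0
  𝒢-≡ eq v = trans (cong 𝒢 eq) (HasValue.value v)

  value : ∀ n → 𝒢 (T⁰ n) ≡ 0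
  value zero    = 𝒢-≡ {T⁰ zero} refl 0-1-HasValue
  value (suc n) = 𝒢-≡ {T⁰ (suc n)} refl (diagonal-HasValue n)

  term : ∀ a b → HasValue 0 a b → a ≤ b → (a , b) isTermOf T⁰
  term 0 b v _ = 0 , cong (0 ,_) (HasValue-functional 0-1-HasValue v)
  term 1 b v 1≤b =
    contradiction (subst (1 ≤_) (HasValue-functional v (HasValue-swap 0-1-HasValue)) 1≤b) λ ()
  term (suc (suc n)) b v _ =
    suc n , cong (2 + n ,_) (HasValue-functional (diagonal-HasValue n) v)

  sorted : ∀ {i j} → i < j → proj₁ (T⁰ i) < proj₁ (T⁰ j)
  sorted {zero}  {suc j} _         = s≤s z≤n
  sorted {suc i} {suc j} (s≤s i<j) = s≤s (s≤s i<j)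

-- One step of the algorithm.

module _ {g S} (isG : IsGSequence g S) where
  open IsGSequence isG

  term-HasValue : ∀ n → HasValue g (proj₁ (S n)) (proj₂ (S n))
  term-HasValue n = has-value (legal n) (value n)

  abstract
    HasValue⇒isTermOf : ∀ {a b} → HasValue g a b → a ≤ b → (a , b) isTermOf S
    HasValue⇒isTermOf (has-value l eq) a≤b = complete _ _ l a≤b eq

  sorted⁻¹ : ∀ {i j} → proj₁ (S i) < proj₁ (S j) → i < j
  sorted⁻¹ {i} {j} Si<Sj with <-cmp i j
  ... | tri< i<j _ _  = i<j
  ... | tri≈ _ refl _ = contradiction Si<Sj (<-irrefl refl)
  ... | tri> _ _ j<i  = contradiction Si<Sj (<-asym (sorted j<i))

-- Agreement of `T g` with `S` is assumed before `n` alone, so the same step shows that the true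
-- sequences form an output and that an arbitrary output equals them.
module AlgorithmStep
  (T : ℕ → PairSeq) {g S} (isG : IsGSequence g S) (n : ℕ)
  (prior : ∀ {i} → i < n → T g i ≡ S i)
  where
  open IsGSequence isG

  used-first : ∀ {i a b} → i < n → S i ≡ (a , b) → UsedBefore T g n a
  used-first {i} i<n eq = i , i<n , inj₁ (sym (cong proj₁ (trans (prior i<n) eq)))

  used-second : ∀ {i a b} → i < n → S i ≡ (a , b) → UsedBefore T g n b
  used-second {i} i<n eq = i , i<n , inj₂ (sym (cong proj₂ (trans (prior i<n) eq)))

  first-isMex : IsMex (UsedBefore T g n) (proj₁ (S n))
  first-isMex = unused , below-used
    where
    unused : ¬ UsedBefore T g n (proj₁ (S n))
    unused (i , i<n , inj₁ eq) =
      <⇒≢ (sorted i<n) (sym (trans eq (cong proj₁ (prior i<n))))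
    -- By symmetry, the partner of the first coordinate of `S n` would be the first coordinate of
    -- `S i`, which is smaller, against `ordered`.
    unused (i , i<n , inj₂ eq) =
      <⇒≱ (sorted i<n) (subst (proj₁ (S n) ≤_) Sn₂≡Si₁ (ordered n))
      where
      Sn₂≡Si₁ : proj₂ (S n) ≡ proj₁ (S i)
      Sn₂≡Si₁ = HasValue-functional (term-HasValue isG n)
        (subst (λ m → HasValue g m (proj₁ (S i))) (sym (trans eq (cong proj₂ (prior i<n))))
          (HasValue-swap (term-HasValue isG i)))

    below-used : ∀ k → k < proj₁ (S n) → ¬ ¬ UsedBefore T g n k
    -- The pair of `k` and its partner, put in order, is a term; its smaller coordinate is at most
    -- `k`, so its index is below `n`.
    below-used k k<x k∉ with partner-HasValue g k | ≤-total k (partner g k)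
    ... | v | inj₁ k≤b with i , eq ← HasValue⇒isTermOf isG v k≤b =
      k∉ (used-first (sorted⁻¹ isG (subst (_< _) (sym (cong proj₁ eq)) k<x)) eq)
    ... | v | inj₂ b≤k with i , eq ← HasValue⇒isTermOf isG (HasValue-swap v) b≤k =
      k∉ (used-second (sorted⁻¹ isG (subst (_< _) (sym (cong proj₁ eq)) (≤-<-trans b≤k k<x))) eq)

  module _ (lower : ∀ {k} → k < g → IsGSequence k (T k)) where

    second-isLeast : ∀ {z} → proj₂ (S n) ≡ proj₁ (S n) + z →
                     IsLeast (Admissible T g n (proj₁ (S n))) z
    second-isLeast {z} y≡x+z = admissible , minimal
      where
      x : ℕ
      x = proj₁ (S n)

      v : HasValue g x (x + z)
      v = subst (HasValue g x) y≡x+z (term-HasValue isG n)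

      admissible : Admissible T g n x z
      admissible = record { legal = HasValue.legal v ; cond-a = cond-a ; cond-b = cond-b }
        where
        cond-a : ∀ l → l < n → x + z ≢ proj₂ (T g l)
        cond-a l l<n eq = <⇒≢ (sorted l<n) (HasValue-injective (term-HasValue isG l)
          (subst (HasValue g x) (trans eq (cong proj₂ (prior l<n))) v))

        cond-b : ∀ k → k < g → ¬ (x , x + z) isTermOf T k
        cond-b k k<g (i , eq) = <⇒≢ k<g
          (trans (sym (IsGSequence.value (lower k<g) i)) (trans (cong 𝒢 eq) (HasValue.value v)))

      minimal : ∀ w → w < z → ¬ Admissible T g n x w
      minimal w w<z adm with h , u ← Legal⇒HasValue (Admissible.legal adm) with <-cmp h g
      ... | tri< h<g _ _ =
        Admissible.cond-b adm h h<g (HasValue⇒isTermOf (lower h<g) u (m≤m+n x w))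
      ... | tri≈ _ refl _ = HasValue-once (+-monoʳ-< x w<z) u v
      ... | tri> _ _ g<h = HasValue-option u g<h taken
        -- Row `x` has its `g` in column `x + z`, to the right of `x + w`, so the option of value
        -- `g` cannot lie in this row.
        λ b<x+w t → HasValue-once (<-trans b<x+w (+-monoʳ-< x w<z)) t v
        where
        taken : ∀ {a} → a < x → ¬ HasValue g a (x + w)
        taken a<x t
          with i , Si≡ ← HasValue⇒isTermOf isG t (<⇒≤ (<-≤-trans a<x (m≤m+n x w)))
          with i<n ← sorted⁻¹ isG (subst (_< x) (sym (cong proj₁ Si≡)) a<x) =
          Admissible.cond-a adm i i<n (sym (cong proj₂ (trans (prior i<n) Si≡)))

-- Existence and uniqueness of the output.

-- Assembled from the sequences already constructed instead of run as a recursion.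
algorithm : ℕ → PairSeq
algorithm zero    = T⁰
algorithm (suc g) = gSequence (suc g)

algorithm-isGSequence : ∀ g → IsGSequence g (algorithm g)
algorithm-isGSequence zero    = T⁰-isGSequence
algorithm-isGSequence (suc g) = gSequence-isGSequence (suc g)

algorithm-isOutput : IsAlgorithmOutput algorithm
algorithm-isOutput = record
  { base  = λ _ → refl
  ; step₁ = λ g n _ → Step.first-isMex g n
  ; step₂ = λ g n _ →
      let x , y = algorithm g n
          y≡x+z = sym (m+[n∸m]≡n (IsGSequence.ordered (algorithm-isGSequence g) n))
      in y ∸ x , Step.second-isLeast g n (λ {k} _ → algorithm-isGSequence k) y≡x+z , y≡x+z
  }
  where
  module Step g n = AlgorithmStep algorithm (algorithm-isGSequence g) n (λ _ → refl)

module _ {T} (isOutput : IsAlgorithmOutput T) where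
  open IsAlgorithmOutput isOutput

  output-unique : ∀ {g} → g ≥ 1 → (∀ {k} → k < g → IsGSequence k (T k)) →
                  ∀ {S} → IsGSequence g S → ∀ n → T g n ≡ S n
  output-unique {g} g≥1 lower {S} isG = <-rec _ λ n prior → unique-term n prior
    where
    unique-term : ∀ n → (∀ {i} → i < n → T g i ≡ S i) → T g n ≡ S n
    unique-term n prior with z , z-least , y≡ ← step₂ g n g≥1 =
      cong₂ _,_ x≡x′ (trans y≡ (trans (cong₂ _+_ x≡x′ z≡z′) (sym y′≡)))
      where
      open AlgorithmStep T isG n prior

      x≡x′ : proj₁ (T g n) ≡ proj₁ (S n)
      x≡x′ = IsLeast-unique (step₁ g n g≥1) first-isMex

      y′≡ : proj₂ (S n) ≡ proj₁ (S n) + (proj₂ (S n) ∸ proj₁ (S n))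
      y′≡ = sym (m+[n∸m]≡n (IsGSequence.ordered isG n))

      z≡z′ : z ≡ proj₂ (S n) ∸ proj₁ (S n)
      -- `z-least` concerns the first coordinate of `T g n` and is transported to that of `S n`
      -- before the comparison.
      z≡z′ = IsLeast-unique (subst (λ x → IsLeast (Admissible T g n x) z) x≡x′ z-least)
        (second-isLeast lower y′≡)

  -- Strong induction on `g` supplies the hypothesis `lower` of `output-unique`.
  output-isGSequence : ∀ g → IsGSequence g (T g)
  output-isGSequence = <-rec _ step
    where
    step : ∀ g → (∀ {k} → k < g → IsGSequence k (T k)) → IsGSequence g (T g)
    step zero    _     = IsGSequence-resp base T⁰-isGSequence
    step (suc g) lower = IsGSequence-resp
      (output-unique (s≤s z≤n) lower (gSequence-isGSequence (suc g)))
      (gSequence-isGSequence (suc g))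

-- The first two conjuncts ensure that the third is not vacuous.
theorem3 : ∃ IsAlgorithmOutput
    × (∀ g → g ≥ 1 → ∃ (IsGSequence g))
    × (∀ T → IsAlgorithmOutput T →
    ∀ g → g ≥ 1 → ∀ S → IsGSequence g S →
    ∀ n → T g n ≡ S n)
theorem3 =
  (algorithm , algorithm-isOutput) ,
  (λ g _ → gSequence g , gSequence-isGSequence g) ,
  λ T isOutput g g≥1 S isG →
    output-unique isOutput g≥1 (λ {k} _ → output-isGSequence isOutput k) isG
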